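{- Any Kirby-Paris Hydra is eventually slain, no matter the strategy; that is, the rewrite relation $\to_{\mathit{KP}}$ on Kirby-Paris Hydras is terminating (there is no infinite sequence $h_0\to_{\mathit{KP}}h_1\to_{\mathit{KP}}h_2\to_{\mathit{KP}}\cdots$ of Kirby-Paris Hydras).
   Context: A Kirby-Paris Hydra is a finite rooted unordered tree with nodes labeled from $S=\{0,\dagger\}$, where the label $\dagger$ labels only the root. A tree with root label $f$ and immediate subtrees $t_1,\ldots,t_n$ ($n\ge0$) is written $f(t_1,\ldots,t_n)$, and $f$ if $n=0$; the order of the arguments is irrelevant. The relation $\to_{\mathit{KP}}$ is the rewrite relation (applicable at any subtree of a Hydra) given by the following rule schemas, where $\vec t,\vec t_1,\vec t_2$ are arbitrary finite (possibly empty) sequences of trees: (KP$_1$) $\dagger(\vec t,0)\to\dagger(\vec t)$; (KP$_2$) $f(\vec t_1,0(\vec t_2,0))\to f(\vec t_1,\underbrace{0(\vec t_2),\ldots,0(\vec t_2)}_{k\text{ times}})$ for any $f\in S$ and any $k\in\mathbb{N}$ (including $k=0$), where $k$ can be chosen freely at each step. -}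

module Defs where

open import Data.List using (List; []; _∷_; [_]; _++_; replicate)
open import Data.List.Relation.Binary.Permutation.Homogeneous using (Permutation)
open import Data.List.Relation.Unary.All using (All)
open import Data.Nat using (ℕ; suc)
open import Data.Product using (Σ; ∃; ∃₂; _×_; proj₁)
open import Function using (_on_)
open import Level using (Level; 0ℓ)
open import Relation.Binary using (Rel)
open import Relation.Nullary using (¬_)

infix 30 _⟨_⟩
infix 4 _≈_ _⟶_ _→KP_

data Label : Set where
  𝟎 † : Label

-- `f ⟨ ts ⟩` is an ordered representative of the tree f(ts); unordered trees
-- are these representatives taken up to the equivalence _≈_ below.
data Tree : Set where
  _⟨_⟩ : Label → List Tree → Tree

-- Equality of unordered trees: `Permutation _≈_` is permutation of the
-- arguments up to _≈_ itself, so reordering is allowed at every node.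
data _≈_ : Rel Tree 0ℓ where
  node : ∀ {f ts us} → Permutation _≈_ ts us → f ⟨ ts ⟩ ≈ f ⟨ us ⟩

data †-Free : Tree → Set where
  node : ∀ {ts} → All †-Free ts → †-Free (𝟎 ⟨ ts ⟩)

-- † labels no node other than the root.  The root itself may carry either
-- label.
data IsHydra : Tree → Set where
  node : ∀ {f ts} → All †-Free ts → IsHydra (f ⟨ ts ⟩)

Hydra : Set
Hydra = Σ Tree IsHydra

data Rule : Rel Tree 0ℓ where
  KP₁ : ∀ ts → Rule († ⟨ ts ++ [ 𝟎 ⟨ [] ⟩ ] ⟩) († ⟨ ts ⟩)
  KP₂ : ∀ f ts₁ ts₂ k →
        Rule (f ⟨ ts₁ ++ [ 𝟎 ⟨ ts₂ ++ [ 𝟎 ⟨ [] ⟩ ] ⟩ ] ⟩)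
             (f ⟨ ts₁ ++ replicate k (𝟎 ⟨ ts₂ ⟩) ⟩)

data Step : Rel Tree 0ℓ where
  here  : ∀ {s t} → Rule s t → Step s t
  below : ∀ f ts us {s t} → Step s t →
          Step (f ⟨ ts ++ s ∷ us ⟩) (f ⟨ ts ++ t ∷ us ⟩)

-- Rewriting modulo _≈_, i.e. the relation Step induces on unordered trees.
_⟶_ : Rel Tree 0ℓ
s ⟶ t = ∃₂ λ s′ t′ → s ≈ s′ × Step s′ t′ × t′ ≈ t

_→KP_ : Rel Hydra 0ℓ
_→KP_ = _⟶_ on proj₁

Terminating : ∀ {a ℓ : Level} {A : Set a} → Rel A ℓ → Set _
Terminating {A = A} _⇒_ = ¬ ∃ λ (h : ℕ → A) → ∀ n → h n ⇒ h (suc n)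

{-# OPTIONS --safe #-}
module Submission where

-- Termination holds for all trees, hydra or not. Order trees by a nested
-- multiset order: f(us) ≺ f(ts) when us arises from ts by replacing one
-- argument x with finitely many trees that are all ≺ x. A rewrite step
-- decreases this order (`Step⇒≺`): removing a leaf replaces it with no trees,
-- and (KP₂) replaces 0(t⃗,0) with copies of 0(t⃗), which are ≺ it by the case
-- just mentioned. The order is well-founded by structural induction on trees
-- (`≺-wellFounded`), because such a replacement on lists of accessible
-- elements is well-founded (`∷-accessible`).
--
-- Replacements are defined on ordered lists, without permutations, so that a
-- descent from x ∷ xs acts visibly on x or on xs. Reordering is handled
-- separately: ≈ commutes with ≺, in that s ≈ s′ and t′ ≺ s′ give some t ≺ s
-- with t ≈ t′ (`≈-simulates`). A rewrite sequence modulo ≈ starting at a tree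
-- therefore lifts to an honest ≺-descending sequence of representatives.

open import Defs
open import Data.Empty using (⊥)
open import Data.List using (List; []; _∷_; [_]; _++_)
open import Data.List.Properties using (++-identityʳ)
open import Data.List.Relation.Binary.Permutation.Homogeneous
  using (Permutation; refl; prep; swap; trans)
open import Data.List.Relation.Binary.Pointwise using (Pointwise; []; _∷_)
open import Data.List.Relation.Unary.All using (All; []; _∷_)
open import Data.List.Relation.Unary.All.Properties using (replicate⁺)
open import Data.Nat using (suc)
open import Data.Product using (∃; _×_; _,_; proj₁)
open import Induction.WellFounded using (Acc; acc; WellFounded)
open import Level using (0ℓ)
open import Relation.Binary using (Rel; Reflexive; Transitive)
open import Relation.Binary.PropositionalEquality using (subst)

infix 4 _≺_

-- `Replace _<_ ys xs`: the list ys is xs with one element x replaced, in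
-- place, by a finite (possibly empty) list of elements below x. Up to order
-- this is one step of the multiset extension of _<_.
data Replace {A : Set} (_<_ : Rel A 0ℓ) : Rel (List A) 0ℓ where
  here  : ∀ {x ks xs} → All (_< x) ks → Replace _<_ (ks ++ xs) (x ∷ xs)
  there : ∀ {x ys xs} → Replace _<_ ys xs → Replace _<_ (x ∷ ys) (x ∷ xs)

module _ {A : Set} {_<_ : Rel A 0ℓ} where

  ++-accessible : ∀ {x} →
                  (∀ {k ys} → k < x → Acc (Replace _<_) ys →
                   Acc (Replace _<_) (k ∷ ys)) →
                  ∀ {ks ys} → All (_< x) ks → Acc (Replace _<_) ys →
                  Acc (Replace _<_) (ks ++ ys)
  ++-accessible cons []           a = a
  ++-accessible cons (k<x ∷ ks<x) a = cons k<x (++-accessible cons ks<x a)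

  -- Lexicographic induction on the two hypotheses: replacing the head x
  -- appeals to elements below x, and a replacement in the tail keeps x.
  mutual
    ∷-accessible : ∀ {x xs} → Acc _<_ x → Acc (Replace _<_) xs →
                   Acc (Replace _<_) (x ∷ xs)
    ∷-accessible a b = acc (below-∷ a b)

    below-∷ : ∀ {x xs ys} → Acc _<_ x → Acc (Replace _<_) xs →
              Replace _<_ ys (x ∷ xs) → Acc (Replace _<_) ys
    below-∷ (acc below-x) b (here ks<x) =
      ++-accessible (λ k<x → ∷-accessible (below-x k<x)) ks<x b
    below-∷ a (acc below-xs) (there r) = ∷-accessible a (below-xs r)

  replace-middle : ∀ xs {x ks ys} → All (_< x) ks →
                   Replace _<_ (xs ++ ks ++ ys) (xs ++ x ∷ ys)
  replace-middle []       ks<x = here ks<x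
  replace-middle (_ ∷ xs) ks<x = there (replace-middle xs ks<x)

  replace-last : ∀ xs {x ks} → All (_< x) ks →
                 Replace _<_ (xs ++ ks) (xs ++ [ x ])
  replace-last xs {x} {ks} ks<x =
    subst (λ ls → Replace _<_ (xs ++ ls) (xs ++ [ x ])) (++-identityʳ ks)
          (replace-middle xs ks<x)

-- The nested multiset order: the root label is kept, and one argument is
-- replaced by finitely many smaller trees. It is not transitively closed.
data _≺_ : Rel Tree 0ℓ where
  node : ∀ {f us ts} → Replace _≺_ us ts → f ⟨ us ⟩ ≺ f ⟨ ts ⟩

node-accessible : ∀ {f ts} → Acc (Replace _≺_) ts → Acc _≺_ (f ⟨ ts ⟩)
node-accessible (acc below-ts) = acc λ where
  (node r) → node-accessible (below-ts r)

mutual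
  ≺-wellFounded : WellFounded _≺_
  ≺-wellFounded (f ⟨ ts ⟩) = node-accessible (replace-accessible ts)

  replace-accessible : WellFounded (Replace _≺_)
  replace-accessible []       = acc λ ()
  replace-accessible (t ∷ ts) =
    ∷-accessible (≺-wellFounded t) (replace-accessible ts)

remove-leaf : ∀ f ts → f ⟨ ts ⟩ ≺ f ⟨ ts ++ [ 𝟎 ⟨ [] ⟩ ] ⟩
remove-leaf f ts =
  subst (λ us → f ⟨ us ⟩ ≺ f ⟨ ts ++ [ 𝟎 ⟨ [] ⟩ ] ⟩) (++-identityʳ ts)
        (node (replace-last ts []))

Rule⇒≺ : ∀ {s t} → Rule s t → t ≺ s
Rule⇒≺ (KP₁ ts)          = remove-leaf † ts
Rule⇒≺ (KP₂ f ts₁ ts₂ k) =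
  node (replace-last ts₁ (replicate⁺ k (remove-leaf 𝟎 ts₂)))

Step⇒≺ : ∀ {s t} → Step s t → t ≺ s
Step⇒≺ (here r)          = Rule⇒≺ r
Step⇒≺ (below f ts us s) = node (replace-middle ts (Step⇒≺ s ∷ []))

mutual
  ≈-refl : Reflexive _≈_
  ≈-refl {f ⟨ ts ⟩} = node (refl (≋-refl ts))

  ≋-refl : ∀ ts → Pointwise _≈_ ts ts
  ≋-refl []       = []
  ≋-refl (t ∷ ts) = ≈-refl ∷ ≋-refl ts

≈-trans : Transitive _≈_
≈-trans (node p) (node q) = node (trans p q)

↭-refl : Reflexive (Permutation _≈_)
↭-refl = refl (≋-refl _)

↭-++⁺ : ∀ {ks ls ts us} → Pointwise _≈_ ks ls → Permutation _≈_ ts us →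
        Permutation _≈_ (ks ++ ts) (ls ++ us)
↭-++⁺ []       p = p
↭-++⁺ (e ∷ es) p = prep e (↭-++⁺ es p)

↭-move-in : ∀ {ks ls t u ts us} →
            t ≈ u → Pointwise _≈_ ks ls → Permutation _≈_ ts us →
            Permutation _≈_ (t ∷ ks ++ ts) (ls ++ u ∷ us)
↭-move-in t≈u []       p = prep t≈u p
↭-move-in t≈u (e ∷ es) p =
  trans (swap ≈-refl e ↭-refl) (prep ≈-refl (↭-move-in t≈u es p))

↭-move-out : ∀ {ks ls t u ts us} →
             t ≈ u → Pointwise _≈_ ks ls → Permutation _≈_ ts us →
             Permutation _≈_ (ks ++ t ∷ ts) (u ∷ ls ++ us)
↭-move-out t≈u []       p = prep t≈u p
↭-move-out t≈u (e ∷ es) p =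
  trans (prep ≈-refl (↭-move-out t≈u es p)) (swap e ≈-refl ↭-refl)

-- The recursion is on the derivation of the equality, not on the descent:
-- under `trans` the descent is first carried along the second permutation, and
-- the result bears no structural relation to the original.
mutual
  ≈-simulates : ∀ {s s′ t′} → s ≈ s′ → t′ ≺ s′ → ∃ λ t → t ≺ s × t ≈ t′
  ≈-simulates (node p) (node r) =
    let _ , r′ , q = ↭-simulates p r in _ , node r′ , node q

  ↭-simulates : ∀ {ts ts′ us′} → Permutation _≈_ ts ts′ →
                Replace _≺_ us′ ts′ →
                ∃ λ us → Replace _≺_ us ts × Permutation _≈_ us us′
  ↭-simulates (refl es) r = ≋-simulates es r
  ↭-simulates (prep e p) (here ks≺) =
    let _ , ks′≺ , es = All-simulates e ks≺ in _ , here ks′≺ , ↭-++⁺ es p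
  ↭-simulates (prep e p) (there r) =
    let _ , r′ , q = ↭-simulates p r in _ , there r′ , prep e q
  ↭-simulates (swap e₁ e₂ p) (here ks≺) =
    let _ , ks′≺ , es = All-simulates e₂ ks≺
    in _ , there (here ks′≺) , ↭-move-in e₁ es p
  ↭-simulates (swap e₁ e₂ p) (there (here ks≺)) =
    let _ , ks′≺ , es = All-simulates e₁ ks≺
    in _ , here ks′≺ , ↭-move-out e₂ es p
  ↭-simulates (swap e₁ e₂ p) (there (there r)) =
    let _ , r′ , q = ↭-simulates p r in _ , there (there r′) , swap e₁ e₂ q
  ↭-simulates (trans p₁ p₂) r =
    let _ , r₂ , q₂ = ↭-simulates p₂ r
        _ , r₁ , q₁ = ↭-simulates p₁ r₂
    in _ , r₁ , trans q₁ q₂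

  ≋-simulates : ∀ {ts ts′ us′} → Pointwise _≈_ ts ts′ →
                Replace _≺_ us′ ts′ →
                ∃ λ us → Replace _≺_ us ts × Permutation _≈_ us us′
  ≋-simulates (e ∷ es) (here ks≺) =
    let _ , ks′≺ , ks≋ = All-simulates e ks≺
    in _ , here ks′≺ , ↭-++⁺ ks≋ (refl es)
  ≋-simulates (e ∷ es) (there r) =
    let _ , r′ , q = ≋-simulates es r in _ , there r′ , prep e q

  All-simulates : ∀ {s s′ ks′} → s ≈ s′ → All (_≺ s′) ks′ →
                  ∃ λ ks → All (_≺ s) ks × Pointwise _≈_ ks ks′
  All-simulates e []         = _ , [] , []
  All-simulates e (k≺ ∷ ks≺) =
    let _ , k′≺  , k≈  = ≈-simulates e k≺
        _ , ks′≺ , ks≋ = All-simulates e ks≺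
    in _ , k′≺ ∷ ks′≺ , k≈ ∷ ks≋

⟶-simulates : ∀ {r s t} → r ≈ s → s ⟶ t → ∃ λ r′ → r′ ≺ r × r′ ≈ t
⟶-simulates r≈s (s′ , t′ , s≈s′ , step , t′≈t) =
  let r′ , r′≺r , r′≈t′ = ≈-simulates (≈-trans r≈s s≈s′) (Step⇒≺ step)
  in r′ , r′≺r , ≈-trans r′≈t′ t′≈t

theorem6p4 : Terminating _→KP_
theorem6p4 (h , steps) = no-descent 0 (≺-wellFounded (proj₁ (h 0))) ≈-refl
  where
  -- The tree r is the representative of h n reached by lifting the sequence.
  no-descent : ∀ n {r} → Acc _≺_ r → r ≈ proj₁ (h n) → ⊥
  no-descent n (acc below-r) r≈hn =
    let _ , r′≺r , r′≈ = ⟶-simulates r≈hn (steps n)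
    in no-descent (suc n) (below-r r′≺r) r′≈
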